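{- Let $k \ge 5$ be a natural number, and consider the problem GEP-UW on known undirected ladder graphs $G_{2,n}$, where $n$ is a multiple of $4$, with start vertex $s_0=(1,1)$ and with all edge weights in $\{1,k\}$. The competitive ratio of any deterministic online algorithm $\textsc{alg}$ for this problem is bounded from below by $\frac{11}{9}$; that is, if $\textsc{alg}$ is a deterministic online algorithm, $r$ is a real number and $\alpha\ge 0$ is a constant such that $\mathrm{cost}_{\textsc{alg}}(n,c) \le r\cdot \mathrm{cost}_{\textsc{opt}}(n,c)+\alpha$ for every positive multiple $n$ of $4$ and every weight function $c : E(G_{2,n}) \to \{1,k\}$, then $r \ge \frac{11}{9}$.
   Context: For $m,n\ge 1$, the undirected $m\times n$ grid $G_{m,n}=(V,E)$ has $V=\{(i,j) : 1\le i\le m,\ 1\le j\le n\}$ and edges $\{(i,j),(i+1,j)\}$ for $1\le i\le m-1$, $1\le j\le n$, and $\{(i,j),(i,j+1)\}$ for $1\le i\le m$, $1\le j\le n-1$. The grids $G_{2,n}$ are called ladders. A path is a sequence of vertices in which consecutive vertices are adjacent; vertices (and edges) may be repeated. The cost of a path $v_1,\dots,v_\ell$ under a weight function $c$ is $\sum_{i=1}^{\ell-1} c(\{v_i,v_{i+1}\})$. GEP-UW (graph exploration problem in a known undirected graph structure with unknown edge weights): an agent starts in $s_0$ and must travel along a path that visits every vertex of the graph at least once (it need not return to $s_0$ and may end anywhere), minimizing the cost of the path. In each time step it moves from its current vertex to a neighboring vertex. The agent knows the unweighted graph, $s_0$ and the set of admissible weights from the beginning, but it does not know the weight function $c$. When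 it is in a vertex for the first time (in particular in $s_0$ at the beginning), the weights of all edges incident to that vertex are revealed. The agent has unlimited memory and computing power. A deterministic online algorithm determines each next move as a function of the information revealed so far (the graph, the path traveled so far, and the weights of all edges incident to visited vertices). $\mathrm{cost}_{\textsc{alg}}(n,c)$ is the cost of the path traveled by the agent under $\textsc{alg}$ on $G_{2,n}$ when the weight function is $c$, and $\mathrm{cost}_{\textsc{opt}}(n,c)$ is the minimum cost of a path in $G_{2,n}$ starting in $s_0$ that visits all vertices (computed with full knowledge of $c$). -}

module Defs where

open import Data.Nat.Base as ℕ using (ℕ; zero; suc; NonZero)
open import Data.Nat.Properties as ℕ using ()
open import Data.Integer.Base using (+_)
open import Data.Fin.Base using (Fin; zero; suc; inject₁)
open import Data.Fin.Properties as Fin using ()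
open import Data.List.Base using (List; []; _∷_; [_]; _++_; map; filter; allFin; cartesianProductWith)
open import Data.List.Membership.Propositional using (_∈_)
open import Data.Maybe.Base using (Maybe; just; nothing)
open import Data.Product.Base using (Σ; ∃; _×_; _,_; proj₁; proj₂)
open import Data.Product.Properties using (≡-dec)
open import Data.Rational.Base as ℚ using (ℚ; 0ℚ; 1ℚ; ½; ∣_∣; Positive; positive; 1/_)
open import Data.Rational.Properties as ℚ using ()
open import Data.Rational.Solver using (module +-*-Solver)
open import Data.Sum.Base using (_⊎_)
open import Relation.Binary.Definitions using (DecidableEquality)
open import Relation.Binary.PropositionalEquality using (_≡_; refl; cong; cong₂; sym; trans; subst)
open import Relation.Nullary.Decidable using (Dec; _⊎-dec_)

Vertex : ℕ → ℕ → Set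
Vertex m n = Fin m × Fin n

-- `vertical i j` is {(i,j),(i+1,j)} and `horizontal i j` is {(i,j),(i,j+1)}.
data Edge : ℕ → ℕ → Set where
  vertical   : ∀ {m n} → Fin m → Fin n → Edge (suc m) n
  horizontal : ∀ {m n} → Fin m → Fin n → Edge m (suc n)

endpoints : ∀ {m n} → Edge m n → Vertex m n × Vertex m n
endpoints (vertical   i j) = (inject₁ i , j) , (suc i , j)
endpoints (horizontal i j) = (i , inject₁ j) , (i , suc j)

verticals : ∀ m n → List (Edge m n)
verticals zero    n = []
verticals (suc m) n = cartesianProductWith vertical (allFin m) (allFin n)

horizontals : ∀ m n → List (Edge m n)
horizontals m zero    = []
horizontals m (suc n) = cartesianProductWith horizontal (allFin m) (allFin n)

edges : ∀ m n → List (Edge m n)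
edges m n = verticals m n ++ horizontals m n

module _ {m n : ℕ} where

  _≟ᵛ_ : DecidableEquality (Vertex m n)
  _≟ᵛ_ = ≡-dec Fin._≟_ Fin._≟_

  open import Data.List.Membership.DecPropositional _≟ᵛ_ using (_∈?_)

  Joins : Edge m n → Vertex m n → Vertex m n → Set
  Joins e u v = endpoints e ≡ (u , v) ⊎ endpoints e ≡ (v , u)

  Adjacent : Vertex m n → Vertex m n → Set
  Adjacent u v = ∃ λ e → Joins e u v

  infixl 5 _▷_

  data Path (s : Vertex m n) : Vertex m n → Set where
    start : Path s s
    _▷_   : ∀ {u v} → Path s u → Adjacent u v → Path s v

  visited : ∀ {s v} → Path s v → List (Vertex m n)
  visited {v = v} start   = [ v ]
  visited {v = v} (p ▷ _) = v ∷ visited p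

  VisitsAll : ∀ {s v} → Path s v → Set
  VisitsAll p = ∀ v → v ∈ visited p

  cost : (Edge m n → ℕ) → ∀ {s v} → Path s v → ℕ
  cost c start         = 0
  cost c (p ▷ (e , _)) = cost c p ℕ.+ c e

  Known : ∀ {s v} → Path s v → Edge m n → Set
  Known p e = proj₁ (endpoints e) ∈ visited p ⊎ proj₂ (endpoints e) ∈ visited p

  known? : ∀ {s v} (p : Path s v) (e : Edge m n) → Dec (Known p e)
  known? p e = (proj₁ (endpoints e) ∈? visited p) ⊎-dec (proj₂ (endpoints e) ∈? visited p)

  -- Everything the agent knows about c after travelling along p.  It is a
  -- list and not a function on known edges so that weight functions agreeing
  -- on those edges reveal propositionally equal information.
  revealed : (Edge m n → ℕ) → ∀ {s v} → Path s v → List (Edge m n × ℕ)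
  revealed c p = map (λ e → e , c e) (filter (known? p) (edges m n))

record WeightFunction (k m n : ℕ) : Set where
  field
    weight     : Edge m n → ℕ
    admissible : ∀ e → weight e ≡ 1 ⊎ weight e ≡ k

open WeightFunction public

module _ (n : ℕ) .{{_ : NonZero n}} where

  -- Indices start at 0, so this is the corner (1,1).
  s₀ : Vertex 2 n
  s₀ = zero , first n
    where
    first : ∀ n → .{{NonZero n}} → Fin n
    first (suc _) = zero

  -- The next move as a function of the path travelled and the revealed
  -- weights; the answer `nothing` ends the exploration.
  Strategy : Set
  Strategy = ∀ {v} → Path s₀ v → List (Edge 2 n × ℕ) → Maybe (∃ λ w → Adjacent v w)

  -- The paths the agent has travelled at some point in time, under σ and c.
  data Follows (σ : Strategy) (c : Edge 2 n → ℕ) : ∀ {v} → Path s₀ v → Set where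
    start : Follows σ c start
    _▷_   : ∀ {v w} {p : Path s₀ v} {a : Adjacent v w} →
            Follows σ c p → σ p (revealed c p) ≡ just (w , a) → Follows σ c (p ▷ a)

  record Exploration (σ : Strategy) (c : Edge 2 n → ℕ) : Set where
    field
      {end}     : Vertex 2 n
      path      : Path s₀ end
      follows   : Follows σ c path
      stops     : σ path (revealed c path) ≡ nothing
      visitsAll : VisitsAll path

  record OnlineAlgorithm (k : ℕ) : Set where
    field
      strategy : Strategy
      explores : (c : WeightFunction k 2 n) → Exploration strategy (weight c)

  algCost : ∀ {k} → OnlineAlgorithm k → WeightFunction k 2 n → ℕ
  algCost alg c = cost (weight c) (Exploration.path (OnlineAlgorithm.explores alg c))

  IsOptCost : (Edge 2 n → ℕ) → ℕ → Set
  IsOptCost c opt =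
    (∃ λ v → Σ (Path s₀ v) λ p → VisitsAll p × cost c p ≡ opt) ×
    (∀ {v} (p : Path s₀ v) → VisitsAll p → opt ℕ.≤ cost c p)

-- Reals are Cauchy sequences of rationals, with no quotient taken: the
-- relation _≤ℝ_ and the pointwise operations respect equality of limits.
record ℝ : Set where
  constructor mkℝ
  field
    seq    : ℕ → ℚ
    cauchy : ∀ ε → 0ℚ ℚ.< ε → ∃ λ N → ∀ i j → N ℕ.≤ i → N ℕ.≤ j →
             ∣ seq i ℚ.- seq j ∣ ℚ.≤ ε

open ℝ public

infix  4 _≤ℝ_
infixl 6 _+ℝ_
infixl 7 _*ℝ_

_≤ℝ_ : ℝ → ℝ → Set
x ≤ℝ y = ∀ ε → 0ℚ ℚ.< ε → ∃ λ N → ∀ i → N ℕ.≤ i → seq x i ℚ.≤ seq y i ℚ.+ ε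

fromℚ : ℚ → ℝ
fromℚ q = mkℝ (λ _ → q) λ ε ε>0 → 0 , λ _ _ _ _ →
  subst (ℚ._≤ ε) (sym (cong ∣_∣ (ℚ.+-inverseʳ q))) (ℚ.<⇒≤ ε>0)

fromℕ : ℕ → ℝ
fromℕ n = fromℚ (+ n ℚ./ 1)

private
  half : ∀ {ε} → 0ℚ ℚ.< ε → 0ℚ ℚ.< ½ ℚ.* ε
  half {ε} ε>0 = ℚ.positive⁻¹ (½ ℚ.* ε) {{ℚ.pos*pos⇒pos ½ ε {{positive ε>0}}}}

  halves : ∀ ε → ½ ℚ.* ε ℚ.+ ½ ℚ.* ε ≡ ε
  halves ε = trans (sym (ℚ.*-distribʳ-+ ε ½ ½)) (ℚ.*-identityˡ ε)

  join : ∀ {M N i} → M ℕ.⊔ N ℕ.≤ i → M ℕ.≤ i × N ℕ.≤ i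
  join {M} {N} h = ℕ.m⊔n≤o⇒m≤o M N h , ℕ.m⊔n≤o⇒n≤o M N h

  +-split : ∀ a b c d → (a ℚ.+ b) ℚ.- (c ℚ.+ d) ≡ (a ℚ.- c) ℚ.+ (b ℚ.- d)
  +-split = solve 4 (λ a b c d → (a :+ b) :- (c :+ d) := (a :- c) :+ (b :- d)) refl
    where open +-*-Solver

  *-split : ∀ a b c d → a ℚ.* b ℚ.- c ℚ.* d ≡ a ℚ.* (b ℚ.- d) ℚ.+ d ℚ.* (a ℚ.- c)
  *-split = solve 4 (λ a b c d → a :* b :- c :* d := a :* (b :- d) :+ d :* (a :- c)) refl
    where open +-*-Solver

  shift : ∀ a b → a ≡ (a ℚ.- b) ℚ.+ b
  shift = solve 2 (λ a b → a := (a :- b) :+ b) refl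
    where open +-*-Solver

  tailBounded : (x : ℝ) → ∃ λ N → ∃ λ B → Positive B × (∀ i → N ℕ.≤ i → ∣ seq x i ∣ ℚ.≤ B)
  tailBounded x with cauchy x 1ℚ (ℚ.positive⁻¹ 1ℚ)
  ... | N , h = N , 1ℚ ℚ.+ ∣ seq x N ∣ ,
    ℚ.pos+nonNeg⇒pos 1ℚ ∣ seq x N ∣ {{ℚ.∣-∣-nonNeg (seq x N)}} ,
    λ i N≤i → begin
      ∣ seq x i ∣                             ≡⟨ cong ∣_∣ (shift (seq x i) (seq x N)) ⟩
      ∣ (seq x i ℚ.- seq x N) ℚ.+ seq x N ∣   ≤⟨ ℚ.∣p+q∣≤∣p∣+∣q∣ (seq x i ℚ.- seq x N) (seq x N) ⟩
      ∣ seq x i ℚ.- seq x N ∣ ℚ.+ ∣ seq x N ∣ ≤⟨ ℚ.+-monoˡ-≤ ∣ seq x N ∣ (h i N N≤i ℕ.≤-refl) ⟩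
      1ℚ ℚ.+ ∣ seq x N ∣                      ∎
    where open ℚ.≤-Reasoning

  ∣*∣-mono : ∀ {p q B δ} → Positive B → ∣ p ∣ ℚ.≤ B → ∣ q ∣ ℚ.≤ δ → ∣ p ℚ.* q ∣ ℚ.≤ B ℚ.* δ
  ∣*∣-mono {p} {q} {B} {δ} B>0 p≤B q≤δ = begin
    ∣ p ℚ.* q ∣     ≡⟨ ℚ.∣p*q∣≡∣p∣*∣q∣ p q ⟩
    ∣ p ∣ ℚ.* ∣ q ∣ ≤⟨ ℚ.*-monoʳ-≤-nonNeg ∣ q ∣ {{ℚ.∣-∣-nonNeg q}} p≤B ⟩
    B ℚ.* ∣ q ∣     ≤⟨ ℚ.*-monoˡ-≤-nonNeg B {{ℚ.pos⇒nonNeg B {{B>0}}}} q≤δ ⟩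
    B ℚ.* δ         ∎
    where open ℚ.≤-Reasoning

  share : ∀ A B ε → Positive A → Positive B → 0ℚ ℚ.< ε →
          ∃ λ δ → 0ℚ ℚ.< δ × A ℚ.* δ ℚ.+ B ℚ.* δ ≡ ε
  share A B ε A>0 B>0 ε>0 = go (A ℚ.+ B) refl (ℚ.pos+pos⇒pos A {{A>0}} B {{B>0}})
    where
    go : ∀ S → S ≡ A ℚ.+ B → Positive S → ∃ λ δ → 0ℚ ℚ.< δ × A ℚ.* δ ℚ.+ B ℚ.* δ ≡ ε
    go S S≡A+B S>0 = δ , δ>0 , Sδ≡ε
      where
      open ℚ.≤-Reasoning

      instance
        S≢0 : ℚ.NonZero S
        S≢0 = ℚ.pos⇒nonZero S {{S>0}}

      δ : ℚ
      δ = 1/ S ℚ.* ε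

      δ>0 : 0ℚ ℚ.< δ
      δ>0 = ℚ.positive⁻¹ δ
        {{ℚ.pos*pos⇒pos (1/ S) {{ℚ.1/pos⇒pos S {{S>0}}}} ε {{positive ε>0}}}}

      Sδ≡ε : A ℚ.* δ ℚ.+ B ℚ.* δ ≡ ε
      Sδ≡ε = begin-equality
        A ℚ.* δ ℚ.+ B ℚ.* δ    ≡⟨ ℚ.*-distribʳ-+ δ A B ⟨
        (A ℚ.+ B) ℚ.* δ        ≡⟨ cong (ℚ._* δ) S≡A+B ⟨
        S ℚ.* (1/ S ℚ.* ε)     ≡⟨ ℚ.*-assoc S (1/ S) ε ⟨
        S ℚ.* 1/ S ℚ.* ε       ≡⟨ cong (ℚ._* ε) (ℚ.*-inverseʳ S) ⟩
        1ℚ ℚ.* ε               ≡⟨ ℚ.*-identityˡ ε ⟩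
        ε                      ∎

  productClose : ∀ {A B δ} a b c d → Positive A → Positive B →
                 ∣ a ∣ ℚ.≤ A → ∣ d ∣ ℚ.≤ B → ∣ b ℚ.- d ∣ ℚ.≤ δ → ∣ a ℚ.- c ∣ ℚ.≤ δ →
                 ∣ a ℚ.* b ℚ.- c ℚ.* d ∣ ℚ.≤ A ℚ.* δ ℚ.+ B ℚ.* δ
  productClose {A} {B} {δ} a b c d A>0 B>0 a≤A d≤B b-d≤δ a-c≤δ = begin
    ∣ a ℚ.* b ℚ.- c ℚ.* d ∣
      ≡⟨ cong ∣_∣ (*-split a b c d) ⟩
    ∣ a ℚ.* (b ℚ.- d) ℚ.+ d ℚ.* (a ℚ.- c) ∣
      ≤⟨ ℚ.∣p+q∣≤∣p∣+∣q∣ (a ℚ.* (b ℚ.- d)) (d ℚ.* (a ℚ.- c)) ⟩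
    ∣ a ℚ.* (b ℚ.- d) ∣ ℚ.+ ∣ d ℚ.* (a ℚ.- c) ∣
      ≤⟨ ℚ.+-mono-≤ (∣*∣-mono {a} {b ℚ.- d} A>0 a≤A b-d≤δ)
                    (∣*∣-mono {d} {a ℚ.- c} B>0 d≤B a-c≤δ) ⟩
    A ℚ.* δ ℚ.+ B ℚ.* δ ∎
    where open ℚ.≤-Reasoning

_+ℝ_ : ℝ → ℝ → ℝ
x +ℝ y = mkℝ (λ i → seq x i ℚ.+ seq y i) +-cauchy
  where
  open ℚ.≤-Reasoning
  +-cauchy : ∀ ε → 0ℚ ℚ.< ε → ∃ λ N → ∀ i j → N ℕ.≤ i → N ℕ.≤ j →
             ∣ (seq x i ℚ.+ seq y i) ℚ.- (seq x j ℚ.+ seq y j) ∣ ℚ.≤ ε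
  +-cauchy ε ε>0 with cauchy x (½ ℚ.* ε) (half ε>0) | cauchy y (½ ℚ.* ε) (half ε>0)
  ... | M , f | N , g = M ℕ.⊔ N , λ i j I J → begin
    ∣ (seq x i ℚ.+ seq y i) ℚ.- (seq x j ℚ.+ seq y j) ∣
      ≡⟨ cong ∣_∣ (+-split (seq x i) (seq y i) (seq x j) (seq y j)) ⟩
    ∣ (seq x i ℚ.- seq x j) ℚ.+ (seq y i ℚ.- seq y j) ∣
      ≤⟨ ℚ.∣p+q∣≤∣p∣+∣q∣ (seq x i ℚ.- seq x j) (seq y i ℚ.- seq y j) ⟩
    ∣ seq x i ℚ.- seq x j ∣ ℚ.+ ∣ seq y i ℚ.- seq y j ∣
      ≤⟨ ℚ.+-mono-≤ (f i j (proj₁ (join I)) (proj₁ (join J)))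
                    (g i j (proj₂ (join {M} I)) (proj₂ (join {M} J))) ⟩
    ½ ℚ.* ε ℚ.+ ½ ℚ.* ε
      ≡⟨ halves ε ⟩
    ε ∎

_*ℝ_ : ℝ → ℝ → ℝ
x *ℝ y = mkℝ (λ i → seq x i ℚ.* seq y i) *-cauchy
  where
  *-cauchy : ∀ ε → 0ℚ ℚ.< ε → ∃ λ N → ∀ i j → N ℕ.≤ i → N ℕ.≤ j →
             ∣ seq x i ℚ.* seq y i ℚ.- seq x j ℚ.* seq y j ∣ ℚ.≤ ε
  *-cauchy ε ε>0 =
    let K , A , A>0 , a = tailBounded x
        L , B , B>0 , b = tailBounded y
        δ , δ>0 , Aδ+Bδ≡ε = share A B ε A>0 B>0 ε>0
        M , f = cauchy x δ δ>0
        N , g = cauchy y δ δ>0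
    in (K ℕ.⊔ L) ℕ.⊔ (M ℕ.⊔ N) , λ i j I J →
      let I₁ , I₂ = join {K ℕ.⊔ L} I
          J₁ , J₂ = join {K ℕ.⊔ L} J
      in subst (∣ seq x i ℚ.* seq y i ℚ.- seq x j ℚ.* seq y j ∣ ℚ.≤_) Aδ+Bδ≡ε
           (productClose (seq x i) (seq y i) (seq x j) (seq y j) A>0 B>0
             (a i (proj₁ (join {K} I₁)))
             (b j (proj₂ (join {K} J₁)))
             (g i j (proj₂ (join {M} I₂)) (proj₂ (join {M} J₂)))
             (f i j (proj₁ (join {M} I₂)) (proj₁ (join {M} J₂))))

{-# OPTIONS --safe #-}
module Submission where

-- Cut the ladder into blocks of three columns.  From a block to the next one
-- the upper edge costs 1 and the lower one k.  Inside a block the edges of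
-- cost 1 form a path through its six vertices.  One end of this path is next
-- to the upper left corner, either below it or to its right, and it is a dead
-- end; the adversary puts it on the side where the agent does not go when it
-- first leaves the corner.  Numbering the path 0, …, 5 from the dead end, the
-- agent starts at 1, goes to 2, still has to visit 0 and 5, and leaves the
-- block at 1 or 4, which costs at least 9.  An edge of cost k ≥ 5 never helps,
-- as two positions differ by at most 5.  Visiting the dead end first costs
-- only 7 per block, so that no ratio below 9/7 > 11/9 is possible.

open import Defs
open import Data.Nat.Base hiding (_/_)
open import Data.Nat.Properties
open import Data.Bool.Base using (Bool; true; false; _∨_)
open import Data.Bool.Properties using (∨-zeroʳ)
open import Data.Empty using (⊥; ⊥-elim)
open import Data.Fin.Base as Fin using
  (Fin; suc; toℕ; fromℕ<; inject₁; combine; quotient; remainder)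
open import Data.Fin.Induction using (<-weakInduction)
open import Data.Fin.Patterns
open import Data.Fin.Properties using
  (all?; combine-remQuot; toℕ-combine; toℕ-fromℕ; toℕ-fromℕ<; toℕ-injective; toℕ-inject₁; toℕ<n)
open import Data.List.Base using (_∷_; applyUpTo)
open import Data.List.Membership.Propositional using (_∈_)
open import Data.List.Properties using (map-cong-local)
open import Data.List.Relation.Unary.All as All using ()
open import Data.List.Relation.Unary.All.Properties using (all-filter)
open import Data.List.Relation.Unary.Any using (here; there)
open import Data.Maybe.Base using (nothing; just; maybe′)
open import Data.Nat.ListAction using (sum)
open import Data.Product.Base using (Σ; ∃; _×_; _,_; proj₁; proj₂)
open import Data.Sum.Base as Sum using (_⊎_; inj₁; inj₂)
open import Data.Integer.Base as ℤ using (+_; -[1+_])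
open import Data.Integer.Properties as ℤ using ()
open import Data.Rational.Base as ℚ using (ℚ; mkℚ; 0ℚ; 1ℚ; ↥_; _/_)
open import Data.Rational.Literals using (fromℤ)
open import Data.Rational.Properties as ℚ using ()
open import Data.Rational.Solver using (module +-*-Solver)
open import Data.Nat.Divisibility using (_∣_; ∣m⇒∣m*n; m∣m*n)
open import Data.Nat.Induction using (<-rec)
open import Data.Nat.Tactic.RingSolver using (solve-∀)
open import Function.Base using (_∘_; case_of_)
open import Relation.Binary.PropositionalEquality
open import Relation.Nullary.Negation.Core using (¬_)
open import Relation.Nullary.Decidable using (Dec; yes; no; True; toWitness; from-yes; _→-dec_)
open import Algebra.Properties.CommutativeSemigroup +-commutativeSemigroup
  using () renaming (interchange to +-exchange)

-- Finite sums

infix 8 ∑[_]_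

∑[_]_ : ℕ → (ℕ → ℕ) → ℕ
∑[ m ] f = sum (applyUpTo f m)

∑-zero : ∀ m → ∑[ m ] (λ _ → 0) ≡ 0
∑-zero zero    = refl
∑-zero (suc m) = ∑-zero m

∑-mono : ∀ m {f g : ℕ → ℕ} → (∀ i → i < m → f i ≤ g i) → ∑[ m ] f ≤ ∑[ m ] g
∑-mono zero    f≤g = z≤n
∑-mono (suc m) f≤g = +-mono-≤ (f≤g 0 z<s) (∑-mono m λ i i<m → f≤g (suc i) (s<s i<m))

∑-+ : ∀ m (f g : ℕ → ℕ) → ∑[ m ] (λ i → f i + g i) ≡ ∑[ m ] f + ∑[ m ] g
∑-+ zero    f g = refl
∑-+ (suc m) f g = begin
  f 0 + g 0 + ∑[ m ] (λ i → f (suc i) + g (suc i))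
    ≡⟨ cong (λ x → f 0 + g 0 + x) (∑-+ m (f ∘ suc) (g ∘ suc)) ⟩
  f 0 + g 0 + (∑[ m ] (f ∘ suc) + ∑[ m ] (g ∘ suc)) ≡⟨ +-exchange (f 0) (g 0) _ _ ⟩
  f 0 + ∑[ m ] (f ∘ suc) + (g 0 + ∑[ m ] (g ∘ suc)) ∎
  where open ≡-Reasoning

∑-const : ∀ m c → ∑[ m ] (λ _ → c) ≡ m * c
∑-const zero    c = refl
∑-const (suc m) c = cong (λ x → c + x) (∑-const m c)

-- Geometry of the blocks

data Place : Set where
  before after : Place
  at           : Fin 2 → Fin 3 → Place

place : Fin 2 → ℕ → ℕ → Place
place r zero    zero                = at r 0F
place r zero    (suc zero)          = at r 1F
place r zero    (suc (suc zero))    = at r 2F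
place r zero    (suc (suc (suc j))) = after
place r (suc i) zero                = before
place r (suc i) (suc zero)          = before
place r (suc i) (suc (suc zero))    = before
place r (suc i) (suc (suc (suc j))) = place r i j

placeOf : ∀ {n} → ℕ → Vertex 2 n → Place
placeOf i (r , j) = place r i (toℕ j)

-- The side of the upper left corner on which the dead end lies.
data Plan : Set where
  below ahead : Plan

-- The cheap edges of a block form a path with six vertices; it is numbered
-- from the dead end.  The sides of the block are attached where a cheap
-- crossing edge leads.
position : Plan → Place → Fin 6
position _     before     = 1F
position _     after      = 4F
position below (at 0F 0F) = 1F
position below (at 0F 1F) = 2F
position below (at 0F 2F) = 5F
position below (at 1F 0F) = 0F
position below (at 1F 1F) = 3F
position below (at 1F 2F) = 4F
position ahead (at 0F 0F) = 1F
position ahead (at 0F 1F) = 0F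
position ahead (at 0F 2F) = 5F
position ahead (at 1F 0F) = 2F
position ahead (at 1F 1F) = 3F
position ahead (at 1F 2F) = 4F

-- Edge prices and their dependence on the plans

data Price : Set where
  cheap dear : Price

rungPrice railPrice : Plan → Price
rungPrice below = cheap
rungPrice ahead = dear
railPrice below = dear
railPrice ahead = cheap

verticalPrice : (ℕ → Plan) → ℕ → Price
verticalPrice M zero                = cheap
verticalPrice M (suc zero)          = rungPrice (M 0)
verticalPrice M (suc (suc zero))    = cheap
verticalPrice M (suc (suc (suc j))) = verticalPrice (M ∘ suc) j

horizontalPrice : Fin 2 → (ℕ → Plan) → ℕ → Price
horizontalPrice 0F M zero                = cheap
horizontalPrice 0F M (suc zero)          = dear
horizontalPrice 0F M (suc (suc zero))    = cheap
horizontalPrice 1F M zero                = railPrice (M 0)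
horizontalPrice 1F M (suc zero)          = cheap
horizontalPrice 1F M (suc (suc zero))    = dear
horizontalPrice r  M (suc (suc (suc j))) = horizontalPrice r (M ∘ suc) j

edgePrice : ∀ {n} → (ℕ → Plan) → Edge 2 n → Price
edgePrice M (vertical   _ j) = verticalPrice M (toℕ j)
edgePrice M (horizontal r j) = horizontalPrice r M (toℕ j)

-- The places that reveal nothing about the plan of a block: while the agent has seen only these,
-- the adversary is still free to choose.
data Start : Place → Set where
  before : Start before
  corner : Start (at 0F 0F)

Start-place : ∀ i → Start (place 0F i 0)
Start-place zero    = corner
Start-place (suc i) = before

position-Start : ∀ pl {q} → Start q → position pl q ≡ 1F
position-Start below before = refl
position-Start below corner = refl
position-Start ahead before = refl
position-Start ahead corner = refl

module _ where

  private
    same : ∀ {q} {pl pl′ : Plan} → Start q ⊎ pl ≡ pl′ → (Start q → ⊥) → pl ≡ pl′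
    same (inj₁ st) ¬st = ⊥-elim (¬st st)
    same (inj₂ eq) _   = eq

  verticalPrice-cong : ∀ {M M′} r j → (∀ i → Start (place r i j) ⊎ M i ≡ M′ i) →
                       verticalPrice M j ≡ verticalPrice M′ j
  verticalPrice-cong r zero                h = refl
  verticalPrice-cong r (suc zero)          h = cong rungPrice (same (h 0) λ ())
  verticalPrice-cong r (suc (suc zero))    h = refl
  verticalPrice-cong r (suc (suc (suc j))) h = verticalPrice-cong r j (h ∘ suc)

  horizontalPrice-congˡ : ∀ {M M′} r j → (∀ i → Start (place r i j) ⊎ M i ≡ M′ i) →
                          horizontalPrice r M j ≡ horizontalPrice r M′ j
  horizontalPrice-congˡ 0F zero                h = refl
  horizontalPrice-congˡ 0F (suc zero)          h = refl
  horizontalPrice-congˡ 0F (suc (suc zero))    h = refl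
  horizontalPrice-congˡ 1F zero                h = cong railPrice (same (h 0) λ ())
  horizontalPrice-congˡ 1F (suc zero)          h = refl
  horizontalPrice-congˡ 1F (suc (suc zero))    h = refl
  horizontalPrice-congˡ 0F (suc (suc (suc j))) h = horizontalPrice-congˡ 0F j (h ∘ suc)
  horizontalPrice-congˡ 1F (suc (suc (suc j))) h = horizontalPrice-congˡ 1F j (h ∘ suc)

  horizontalPrice-congʳ : ∀ {M M′} r j → (∀ i → Start (place r i (suc j)) ⊎ M i ≡ M′ i) →
                          horizontalPrice r M j ≡ horizontalPrice r M′ j
  horizontalPrice-congʳ 0F zero                h = refl
  horizontalPrice-congʳ 0F (suc zero)          h = refl
  horizontalPrice-congʳ 0F (suc (suc zero))    h = refl
  horizontalPrice-congʳ 1F zero                h = cong railPrice (same (h 0) λ ())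
  horizontalPrice-congʳ 1F (suc zero)          h = refl
  horizontalPrice-congʳ 1F (suc (suc zero))    h = refl
  horizontalPrice-congʳ 0F (suc (suc (suc j))) h = horizontalPrice-congʳ 0F j (h ∘ suc)
  horizontalPrice-congʳ 1F (suc (suc (suc j))) h = horizontalPrice-congʳ 1F j (h ∘ suc)

-- Only the middle rung and the lower left rail of a block depend on its plan, and neither ends in a
-- `Start` place of that block; so for these two edges the hypothesis supplies equal plans.
edgePrice-cong : ∀ {n} {M M′} (e : Edge 2 n) {u} →
                 u ≡ proj₁ (endpoints e) ⊎ u ≡ proj₂ (endpoints e) →
                 (∀ i → Start (placeOf i u) ⊎ M i ≡ M′ i) →
                 edgePrice M e ≡ edgePrice M′ e
edgePrice-cong (vertical 0F j)  (inj₁ refl) h = verticalPrice-cong 0F (toℕ j) h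
edgePrice-cong (vertical 0F j)  (inj₂ refl) h = verticalPrice-cong 1F (toℕ j) h
edgePrice-cong (horizontal r j) (inj₁ refl) h =
  horizontalPrice-congˡ r (toℕ j) (subst (λ j → ∀ i → Start (place r i j) ⊎ _) (toℕ-inject₁ j) h)
edgePrice-cong (horizontal r j) (inj₂ refl) h = horizontalPrice-congʳ r (toℕ j) h

-- Moves measured along the cheap paths

stride : Plan → Place → Place → ℕ
stride pl q q′ = ∣ toℕ (position pl q) - toℕ (position pl q′) ∣

module _ (k : ℕ) where

  value : Price → ℕ
  value cheap = 1
  value dear  = k

  module _ (5≤k : 5 ≤ k) where

    private
      dear≥ : ∀ x {x≤5 : True (x ≤? 5)} → x ≤ k
      dear≥ x {x≤5} = ≤-trans (toWitness x≤5) 5≤k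

      join≤ : ∀ {x y b} → x ≤ b → y ≤ 0 → x + y ≤ b
      join≤ {b = b} x≤b y≤0 = ≤-trans (+-mono-≤ x≤b y≤0) (≤-reflexive (+-identityʳ b))

      alone : ∀ m {x b} → x ≤ b → x + ∑[ m ] (λ _ → 0) ≤ b
      alone m x≤b = join≤ x≤b (≤-reflexive (∑-zero m))

    vertical-strides : ∀ m M j →
      ∑[ m ] (λ i → stride (M i) (place 0F i j) (place 1F i j)) ≤ value (verticalPrice M j)
    vertical-strides zero    M j = z≤n
    vertical-strides (suc m) M 0 = alone m (h (M 0))
      where
      h : ∀ pl → stride pl (at 0F 0F) (at 1F 0F) ≤ 1
      h below = ≤-refl
      h ahead = ≤-refl
    vertical-strides (suc m) M 1 = alone m (h (M 0))
      where
      h : ∀ pl → stride pl (at 0F 1F) (at 1F 1F) ≤ value (rungPrice pl)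
      h below = ≤-refl
      h ahead = dear≥ 3
    vertical-strides (suc m) M 2 = alone m (h (M 0))
      where
      h : ∀ pl → stride pl (at 0F 2F) (at 1F 2F) ≤ 1
      h below = ≤-refl
      h ahead = ≤-refl
    vertical-strides (suc m) M (suc (suc (suc j))) = vertical-strides m (M ∘ suc) j

    horizontal-strides : ∀ m M r j →
      ∑[ m ] (λ i → stride (M i) (place r i j) (place r i (suc j))) ≤ value (horizontalPrice r M j)
    horizontal-strides zero    M r  j = z≤n
    horizontal-strides (suc m) M 0F 0 = alone m (h (M 0))
      where
      h : ∀ pl → stride pl (at 0F 0F) (at 0F 1F) ≤ 1
      h below = ≤-refl
      h ahead = ≤-refl
    horizontal-strides (suc m) M 0F 1 = alone m (h (M 0))
      where
      h : ∀ pl → stride pl (at 0F 1F) (at 0F 2F) ≤ k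
      h below = dear≥ 3
      -- The upper middle rail joins the two ends of the cheap path here, which uses `5≤k` in full.
      h ahead = dear≥ 5
    -- Crossing edges alone touch two blocks. The upper one moves from 5 to 4 in the left block and
    -- stays at 1 in the right block; the lower one stays at 4 on the left and moves by one on the
    -- right.
    horizontal-strides (suc m) M 0F 2 = join≤ (h (M 0)) (g m (M ∘ suc))
      where
      h : ∀ pl → stride pl (at 0F 2F) after ≤ 1
      h below = ≤-refl
      h ahead = ≤-refl
      g : ∀ m (N : ℕ → Plan) → ∑[ m ] (λ i → stride (N i) (place 0F (suc i) 2) (place 0F i 0)) ≤ 0
      g zero    N = z≤n
      g (suc m) N = alone m (d (N 0))
        where
        d : ∀ pl → stride pl before (at 0F 0F) ≤ 0
        d below = z≤n
        d ahead = z≤n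
    horizontal-strides (suc m) M 1F 0 = alone m (h (M 0))
      where
      h : ∀ pl → stride pl (at 1F 0F) (at 1F 1F) ≤ value (railPrice pl)
      h below = dear≥ 3
      h ahead = ≤-refl
    horizontal-strides (suc m) M 1F 1 = alone m (h (M 0))
      where
      h : ∀ pl → stride pl (at 1F 1F) (at 1F 2F) ≤ 1
      h below = ≤-refl
      h ahead = ≤-refl
    horizontal-strides (suc m) M 1F 2 = +-mono-≤ (h (M 0)) (g m (M ∘ suc))
      where
      h : ∀ pl → stride pl (at 1F 2F) after ≤ 0
      h below = z≤n
      h ahead = z≤n
      d : ∀ pl → stride pl before (at 1F 0F) ≤ k
      d below = dear≥ 1
      d ahead = dear≥ 1
      g : ∀ m (N : ℕ → Plan) → ∑[ m ] (λ i → stride (N i) (place 1F (suc i) 2) (place 1F i 0)) ≤ k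
      g zero    N = z≤n
      g (suc m) N = alone m (d (N 0))
    horizontal-strides (suc m) M 0F (suc (suc (suc j))) = horizontal-strides m (M ∘ suc) 0F j
    horizontal-strides (suc m) M 1F (suc (suc (suc j))) = horizontal-strides m (M ∘ suc) 1F j

    private
      strides-forward : ∀ {n} m M (e : Edge 2 n) → let u , v = endpoints e in
        ∑[ m ] (λ i → stride (M i) (placeOf i u) (placeOf i v)) ≤ value (edgePrice M e)
      strides-forward m M (vertical 0F j) = vertical-strides m M (toℕ j)
      strides-forward m M (horizontal r j) rewrite toℕ-inject₁ j = horizontal-strides m M r (toℕ j)

    -- A cheap edge inside a block joins neighbouring positions, a dear one positions at most 5
    -- apart; every block that the edge does not touch has both ends on the same side and adds 0.
    strides : ∀ {n} m M (e : Edge 2 n) {u v} → Joins e u v →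
              ∑[ m ] (λ i → stride (M i) (placeOf i u) (placeOf i v)) ≤ value (edgePrice M e)
    strides m M e (inj₁ refl) = strides-forward m M e
    strides m M e {u} {v} (inj₂ refl) = ≤-trans
      (∑-mono m λ i _ → ≤-reflexive
        (∣-∣-comm (toℕ (position (M i) (placeOf i u))) (toℕ (position (M i) (placeOf i v)))))
      (strides-forward m M e)

-- The agent inside one block

-- The two Booleans tell whether the first and the last vertex of the cheap
-- path are visited.
data Stage : Set where
  waiting : Stage
  walking : Plan → Bool → Bool → Stage

isFirst isLast : Fin 6 → Bool
isFirst 0F = true
isFirst _  = false
isLast 5F = true
isLast _  = false

mark : Plan → Bool → Bool → Place → Stage
mark pl a b q = walking pl (a ∨ isFirst (position pl q)) (b ∨ isLast (position pl q))

-- The adversary decides here. Every first entry other than the one at the upper middle vertex, also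
-- one along the lower crossing edge, puts the dead end ahead; in each case the agent has missed it.
arrive : Stage → Place → Stage
arrive waiting         before     = waiting
arrive waiting         (at 0F 0F) = waiting
arrive waiting         (at 0F 1F) = mark below false false (at 0F 1F)
arrive waiting         q          = mark ahead false false q
arrive (walking pl a b) q         = mark pl a b q

-- The plan of a `waiting` block is an arbitrary default: no weight known so far depends on it.
planOf : Stage → Plan
planOf waiting          = ahead
planOf (walking pl _ _) = pl

data FirstArrival (q : Place) : Stage → Set where
  stay   : Start q → FirstArrival q waiting
  depart : ∀ pl → 2 ≤ toℕ (position pl q) → FirstArrival q (mark pl false false q)

firstArrival : ∀ q → FirstArrival q (arrive waiting q)
firstArrival before     = stay before
firstArrival after      = depart ahead (s≤s (s≤s z≤n))
firstArrival (at 0F 0F) = stay corner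
firstArrival (at 0F 1F) = depart below (s≤s (s≤s z≤n))
firstArrival (at 0F 2F) = depart ahead (s≤s (s≤s z≤n))
firstArrival (at 1F 0F) = depart ahead (s≤s (s≤s z≤n))
firstArrival (at 1F 1F) = depart ahead (s≤s (s≤s z≤n))
firstArrival (at 1F 2F) = depart ahead (s≤s (s≤s z≤n))

-- The invariant that links a stage to the visited vertices. It gives the adversary its freedom
-- while `waiting`, and both flags once everything is visited.
Seen : Stage → Place → Set
Seen waiting          q = Start q
Seen (walking pl a b) q = (position pl q ≡ 0F → a ≡ true) × (position pl q ≡ 5F → b ≡ true)

Seen-mark : ∀ pl a b q → Seen (mark pl a b q) q
Seen-mark pl a b q =
  (λ x≡0 → trans (cong (λ x → a ∨ isFirst x) x≡0) (∨-zeroʳ a)) ,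
  (λ x≡5 → trans (cong (λ x → b ∨ isLast x) x≡5) (∨-zeroʳ b))

Seen-arrive : ∀ s q → Seen (arrive s q) q
Seen-arrive (walking pl a b) q = Seen-mark pl a b q
Seen-arrive waiting          q with arrive waiting q | firstArrival q
... | _ | stay init  = init
... | _ | depart pl _ = Seen-mark pl false false q

arrive-Seen : ∀ s {q} q′ → Seen s q → Seen (arrive s q′) q
arrive-Seen (walking pl a b) q′ (first , last) =
  (λ x≡0 → cong (_∨ _) (first x≡0)) , (λ x≡5 → cong (_∨ _) (last x≡5))
arrive-Seen waiting q′ init with arrive waiting q′ | firstArrival q′
... | _ | stay _      = init
... | _ | depart pl _ =
  -- What was seen while waiting has position 1, which is neither end, so no flag is owed to it.
  (λ x≡0 → case trans (sym (position-Start pl init)) x≡0 of λ ()) ,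
  (λ x≡5 → case trans (sym (position-Start pl init)) x≡5 of λ ())

-- A chosen plan is never revised, and before the choice only `Start` places have been seen.
arrive-planOf : ∀ s {q} q′ → Seen s q → Start q ⊎ planOf s ≡ planOf (arrive s q′)
arrive-planOf waiting          q′ init = inj₁ init
arrive-planOf (walking pl a b) q′ _     = inj₂ refl

-- A lower bound for the way from 1F to x that leads through 2F and then to the
-- ends that have been visited.
height : Bool → Bool → Fin 6 → ℕ
height false false x = 1 + ∣ 2 - toℕ x ∣
height true  false x = 3 + toℕ x
height false true  x = 9 ∸ toℕ x
height true  true  x = (13 ∸ toℕ x) ⊓ (9 + toℕ x)

-- `height` is a potential that no move raises by more than its length, even when the move sets a
-- flag. The finitely many cases are decided by computation.
height-step : ∀ a b x y → height (a ∨ isFirst y) (b ∨ isLast y) y ≤ height a b x + ∣ toℕ x - toℕ y ∣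
height-step = λ where
    false false → from-yes (step? false false)
    true  false → from-yes (step? true false)
    false true  → from-yes (step? false true)
    true  true  → from-yes (step? true true)
  where
  step? : ∀ a b → Dec (∀ x y →
    height (a ∨ isFirst y) (b ∨ isLast y) y ≤ height a b x + ∣ toℕ x - toℕ y ∣)
  step? a b = all? λ x → all? λ y →
    height (a ∨ isFirst y) (b ∨ isLast y) y ≤? height a b x + ∣ toℕ x - toℕ y ∣

-- The way from 1 to such a `y` passes 2 without a detour. At `y = 0` the claim would read 3 ≤ 1:
-- this is what the choice of the plan gains.
height-depart : ∀ y → 2 ≤ toℕ y → height (isFirst y) (isLast y) y ≤ ∣ 1 - toℕ y ∣
height-depart = from-yes (all? {n = 6} λ y →
  (2 ≤? toℕ y) →-dec (height (isFirst y) (isLast y) y ≤? ∣ 1 - toℕ y ∣))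

altitude : Stage → Place → ℕ
altitude waiting          q = 0
altitude (walking pl a b) q = height a b (position pl q)

altitude-arrive : ∀ s q q′ → Seen s q →
  altitude (arrive s q′) q′ ≤ altitude s q + stride (planOf (arrive s q′)) q q′
altitude-arrive (walking pl a b) q q′ _ = height-step a b (position pl q) (position pl q′)
altitude-arrive waiting q q′ init with arrive waiting q′ | firstArrival q′
... | _ | stay _        = z≤n
-- Up to now the position is 1 under either plan, so the stride may be measured with the plan just
-- chosen.
... | _ | depart pl 2≤x rewrite position-Start pl init = height-depart (position pl q′) 2≤x

-- A path may end at position 5 with both ends seen at height 8. The extra 1 makes up for the
-- crossing edge not taken, and only the block where the path ends can claim it.
inside : Place → ℕ
inside (at _ _) = 1
inside _        = 0

∑-inside : ∀ m r j → ∑[ m ] (λ i → inside (place r i j)) ≤ 1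
∑-inside zero    r j = z≤n
∑-inside (suc m) r 0 = s≤s (≤-reflexive (∑-zero m))
∑-inside (suc m) r 1 = s≤s (≤-reflexive (∑-zero m))
∑-inside (suc m) r 2 = s≤s (≤-reflexive (∑-zero m))
∑-inside (suc m) r (suc (suc (suc j))) = ∑-inside m r j

height-end : ∀ pl q → 9 ≤ height true true (position pl q) + inside q
height-end pl before   = from-yes (9 ≤? 10)
height-end pl after    = from-yes (9 ≤? 9)
height-end pl (at r o) = subst (9 ≤_) (+-comm 1 _) (s≤s (8≤height (position pl (at r o))))
  where
  8≤height : ∀ x → 8 ≤ height true true x
  8≤height = from-yes (all? λ x → 8 ≤? height true true x)

altitude-end : ∀ s q → (∀ r o → Seen s (at r o)) → 9 ≤ altitude s q + inside q
altitude-end waiting             q seen with () ← seen 1F 0F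
altitude-end (walking below a b) q seen
  with refl ← proj₁ (seen 1F 0F) refl | refl ← proj₂ (seen 0F 2F) refl = height-end below q
altitude-end (walking ahead a b) q seen
  with refl ← proj₁ (seen 0F 1F) refl | refl ← proj₂ (seen 0F 2F) refl = height-end ahead q

-- Adaptive weights

module _ {n : ℕ} {s : Vertex 2 n} where

  stage : ∀ {v} → ℕ → Path s v → Stage
  stage i start         = waiting
  stage i (_▷_ {v = v} p _) = arrive (stage i p) (placeOf i v)

  plans : ∀ {v} → Path s v → ℕ → Plan
  plans p i = planOf (stage i p)

  end∈visited : ∀ {v} (p : Path s v) → v ∈ visited p
  end∈visited start   = here refl
  end∈visited (p ▷ _) = here refl

  stage-Seen : (∀ i → Start (placeOf i s)) → ∀ i {u v} (p : Path s v) → u ∈ visited p →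
               Seen (stage i p) (placeOf i u)
  stage-Seen init i start   (here refl) = init i
  stage-Seen init i (p ▷ _) (here refl) = Seen-arrive (stage i p) _
  stage-Seen init i (p ▷ _) (there u∈p) = arrive-Seen (stage i p) _ (stage-Seen init i p u∈p)

  Agree : ∀ {v} → Path s v → (c c′ : Edge 2 n → ℕ) → Set
  Agree p c c′ = ∀ e → Known p e → c e ≡ c′ e

  Agree-▷⁻ : ∀ {c c′ u v} {p : Path s u} {a : Adjacent u v} → Agree (p ▷ a) c c′ → Agree p c c′
  Agree-▷⁻ agree e known = agree e (Sum.map there there known)

  Known-▷ : ∀ {u v} (p : Path s u) (a : Adjacent u v) → Known p (proj₁ a)
  Known-▷ p (e , inj₁ refl) = inj₁ (end∈visited p)
  Known-▷ p (e , inj₂ refl) = inj₂ (end∈visited p)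

  cost-cong : ∀ {c c′ v} (p : Path s v) → Agree p c c′ → cost c p ≡ cost c′ p
  cost-cong start   agree = refl
  cost-cong {c} {c′} (p ▷ a) agree =
    cong₂ _+_ (cost-cong p (Agree-▷⁻ {c} {c′} {a = a} agree))
      (agree (proj₁ a) (Sum.map there there (Known-▷ p a)))

  revealed-cong : ∀ {c c′ v} (p : Path s v) → Agree p c c′ → revealed c p ≡ revealed c′ p
  revealed-cong p agree = map-cong-local
    (All.map (λ {e} known → cong (e ,_) (agree e known)) (all-filter (known? p) (edges 2 n)))

  length : ∀ {v} → Path s v → ℕ
  length start   = 0
  length (p ▷ _) = suc (length p)

  length≤cost : ∀ {c v} → (∀ e → 1 ≤ c e) → (p : Path s v) → length p ≤ cost c p
  length≤cost         1≤c start         = z≤n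
  length≤cost {c = c} 1≤c (p ▷ (e , _)) =
    subst (_≤ cost c p + c e) (+-comm (length p) 1) (+-mono-≤ (length≤cost 1≤c p) (1≤c e))

-- Deterministic play against adaptive weights

module _ {n : ℕ} (σ : Strategy (suc n)) where

  State : Set
  State = ∃ λ v → Path (s₀ (suc n)) v

  advance : (Edge 2 (suc n) → ℕ) → State → State
  advance c (v , p) = maybe′ (λ (w , a) → w , p ▷ a) (v , p) (σ p (revealed c p))

  run : (Edge 2 (suc n) → ℕ) → ℕ → State
  run c zero    = _ , start
  run c (suc t) = advance c (run c t)

  Follows-run : ∀ {c v} {p : Path (s₀ (suc n)) v} →
                Follows (suc n) σ c p → run c (length p) ≡ (v , p)
  Follows-run         start          = refl
  Follows-run {c = c} (follows ▷ eq) rewrite Follows-run follows | eq = refl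

  Follows-cong : ∀ {c c′ v} {p : Path (s₀ (suc n)) v} → Agree p c c′ →
                 Follows (suc n) σ c p → Follows (suc n) σ c′ p
  Follows-cong agree start = start
  Follows-cong {c} {c′} agree (_▷_ {p = p} {a = a} follows eq) =
    Follows-cong (Agree-▷⁻ {c = c} {c′} {a = a} agree) follows ▷
    trans (cong (σ p) (sym (revealed-cong p (Agree-▷⁻ {c = c} {c′} {a = a} agree)))) eq

  run-stop : ∀ {c v} {p : Path (s₀ (suc n)) v} → Follows (suc n) σ c p →
             σ p (revealed c p) ≡ nothing → ∀ {t} → length p ≤ t → run c t ≡ (v , p)
  run-stop {c} {v} {p} follows stop {t} l≤t =
    subst (λ t → run c t ≡ (v , p)) (m∸n+n≡m l≤t) (halt (t ∸ length p))
    where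
    halt : ∀ d → run c (d + length p) ≡ (v , p)
    halt zero    = Follows-run follows
    halt (suc d) rewrite halt d | stop = refl

  module _ (c : ∀ {v} → Path (s₀ (suc n)) v → Edge 2 (suc n) → ℕ)
           (agree : ∀ {u v} (p : Path (s₀ (suc n)) u) (a : Adjacent u v) → Agree p (c p) (c (p ▷ a)))
    where

    -- By `agree`, later choices leave the known weights alone, so all earlier answers of the
    -- strategy remain valid under the latest weights. The horizon `t` ensures an end, as the
    -- strategy is not known to stop against changing weights.
    play : ∀ t → ∃ λ v → Σ (Path (s₀ (suc n)) v) λ p →
           Follows (suc n) σ (c p) p × (t ≤ length p ⊎ σ p (revealed (c p) p) ≡ nothing)
    play zero = _ , start , start , inj₁ z≤n
    play (suc t) with play t
    ... | v , p , follows , inj₂ stop = v , p , follows , inj₂ stop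
    ... | v , p , follows , inj₁ t≤l with σ p (revealed (c p) p) in eq
    ...   | nothing      = v , p , follows , inj₂ eq
    ...   | just (w , a) = w , p ▷ a ,
      Follows-cong (agree p a) follows ▷ trans (cong (σ p) (sym (revealed-cong p (agree p a)))) eq ,
      inj₁ (s≤s t≤l)

    -- By determinism `p` and the path of `E` are stages of one run, and comparing their lengths
    -- settles the matter. `p` comes before `E` because it determines the weights that `E` explores.
    play-exploration : ∀ t →
      ∃ λ v → Σ (Path (s₀ (suc n)) v) λ p → (E : Exploration (suc n) σ (c p)) →
      t ≤ length (Exploration.path E) ⊎
      _≡_ {A = State} (_ , Exploration.path E) (v , p)
    play-exploration t with play t
    ... | v , p , follows , progress =
      v , p , λ E → outcome E (≤-total (length (Exploration.path E)) (length p)) progress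
      where
      outcome : (E : Exploration (suc n) σ (c p)) → let q = Exploration.path E in
                length q ≤ length p ⊎ length p ≤ length q →
                t ≤ length p ⊎ σ p (revealed (c p) p) ≡ nothing →
                t ≤ length q ⊎ _≡_ {A = State} (_ , q) (v , p)
      outcome E (inj₁ q≤p) _ = inj₂ (trans
        (sym (run-stop (Exploration.follows E) (Exploration.stops E) q≤p))
        (Follows-run follows))
      outcome E (inj₂ p≤q) (inj₁ t≤p) = inj₁ (≤-trans t≤p p≤q)
      outcome E (inj₂ p≤q) (inj₂ stop) = inj₂ (trans
        (sym (Follows-run (Exploration.follows E)))
        (run-stop follows stop p≤q))

-- The cost forced by the adversary

module _ {k : ℕ} (5≤k : 5 ≤ k) where

  module _ {n : ℕ} where

    private
      admissible-value : ∀ x → value k x ≡ 1 ⊎ value k x ≡ k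
      admissible-value cheap = inj₁ refl
      admissible-value dear  = inj₂ refl

    weights : (ℕ → Plan) → WeightFunction k 2 n
    weights M = record
      { weight     = λ e → value k (edgePrice M e)
      ; admissible = λ e → admissible-value (edgePrice M e)
      }

    weights-positive : ∀ M e → 1 ≤ weight (weights M) e
    weights-positive M e with edgePrice M e
    ... | cheap = ≤-refl
    ... | dear  = ≤-trans (s≤s z≤n) 5≤k

  module _ {n : ℕ} {s : Vertex 2 n} (init : ∀ i → Start (placeOf i s)) where

    adaptive : ∀ {v} → Path s v → Edge 2 n → ℕ
    adaptive p = weight (weights (plans p))

    adaptive-agree : ∀ {u v} (p : Path s u) (a : Adjacent u v) → Agree p (adaptive p) (adaptive (p ▷ a))
    adaptive-agree {v = v} p a e = λ where
        (inj₁ u∈p) → cong (value k) (edgePrice-cong e (inj₁ refl) (fixed u∈p))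
        (inj₂ u∈p) → cong (value k) (edgePrice-cong e (inj₂ refl) (fixed u∈p))
      where
      fixed : ∀ {u} → u ∈ visited p → ∀ i → Start (placeOf i u) ⊎ plans p i ≡ plans (p ▷ a) i
      fixed u∈p i = arrive-planOf (stage i p) (placeOf i v) (stage-Seen init i p u∈p)

    -- The altitudes of all blocks together form a potential; one move raises it by at most the
    -- total stride, hence by at most the weight of the edge.
    altitude≤cost : ∀ m {v} (p : Path s v) →
      ∑[ m ] (λ i → altitude (stage i p) (placeOf i v)) ≤ cost (adaptive p) p
    altitude≤cost m start = ≤-reflexive (∑-zero m)
    altitude≤cost m (_▷_ {u} {v} p a) = begin
      ∑[ m ] (λ i → altitude (stage i (p ▷ a)) (placeOf i v))
        ≤⟨ ∑-mono m (λ i _ → altitude-arrive (stage i p) (placeOf i u) (placeOf i v)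
                               (stage-Seen init i p (end∈visited p))) ⟩
      ∑[ m ] (λ i → altitude (stage i p) (placeOf i u) + stride (plans (p ▷ a) i) (placeOf i u) (placeOf i v))
        ≡⟨ ∑-+ m (λ i → altitude (stage i p) (placeOf i u)) _ ⟩
      ∑[ m ] (λ i → altitude (stage i p) (placeOf i u)) +
      ∑[ m ] (λ i → stride (plans (p ▷ a) i) (placeOf i u) (placeOf i v))
        ≤⟨ +-mono-≤ (altitude≤cost m p) (strides k 5≤k m (plans (p ▷ a)) (proj₁ a) (proj₂ a)) ⟩
      cost (adaptive p) p + adaptive (p ▷ a) (proj₁ a)
        -- All edges of `p` are known, so a plan fixed by the last move does not change the cost of
        -- `p`.
        ≡⟨ cong (_+ adaptive (p ▷ a) (proj₁ a)) (cost-cong p (adaptive-agree p a)) ⟩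
      cost (adaptive (p ▷ a)) (p ▷ a) ∎
      where open ≤-Reasoning

-- Ladders made of blocks

verticalPrice-combine : ∀ {m} M (i : Fin m) (o : Fin 3) →
  verticalPrice M (toℕ (combine i o)) ≡ verticalPrice (λ _ → M (toℕ i)) (toℕ o)
verticalPrice-combine M 0F      0F = refl
verticalPrice-combine M 0F      1F = refl
verticalPrice-combine M 0F      2F = refl
verticalPrice-combine M (suc i) o  = verticalPrice-combine (M ∘ suc) i o

horizontalPrice-combine : ∀ {m} r M (i : Fin m) (o : Fin 3) →
  horizontalPrice r M (toℕ (combine i o)) ≡ horizontalPrice r (λ _ → M (toℕ i)) (toℕ o)
horizontalPrice-combine 0F M 0F      0F = refl
horizontalPrice-combine 0F M 0F      1F = refl
horizontalPrice-combine 0F M 0F      2F = refl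
horizontalPrice-combine 1F M 0F      0F = refl
horizontalPrice-combine 1F M 0F      1F = refl
horizontalPrice-combine 1F M 0F      2F = refl
horizontalPrice-combine 0F M (suc i) o  = horizontalPrice-combine 0F (M ∘ suc) i o
horizontalPrice-combine 1F M (suc i) o  = horizontalPrice-combine 1F (M ∘ suc) i o

place-combine : ∀ {m} r (i : Fin m) (o : Fin 3) → place r (toℕ i) (toℕ (combine i o)) ≡ at r o
place-combine r 0F      0F = refl
place-combine r 0F      1F = refl
place-combine r 0F      2F = refl
place-combine r (suc i) o  = place-combine r i o

-- Columns given by `combine` do not have the shape `inject₁ j` and `suc j`, so the edge is
-- recovered from their numerical values.
horizontalEdge : ∀ {n} r (u v : Fin n) → toℕ v ≡ suc (toℕ u) →
  Σ (Edge 2 n) λ e → endpoints e ≡ ((r , u) , (r , v)) × (∀ M → edgePrice M e ≡ horizontalPrice r M (toℕ u))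
horizontalEdge r u (suc j) eq =
  horizontal r j ,
  cong (λ u → (r , u) , (r , suc j)) (toℕ-injective (trans (toℕ-inject₁ j) (suc-injective eq))) ,
  λ M → cong (horizontalPrice r M) (suc-injective eq)

module _ {k b : ℕ} (M : ℕ → Plan) where

  private
    n : ℕ
    n = suc b * 3

    column : Fin (suc b) → Fin 3 → Fin n
    column = combine

    c : Edge 2 n → ℕ
    c e = value k (edgePrice M e)

    Cheap : Vertex 2 n → Vertex 2 n → Set
    Cheap u v = Σ (Adjacent u v) λ a → edgePrice M (proj₁ a) ≡ cheap

    back : ∀ {u v} → Cheap u v → Cheap v u
    back ((e , joins) , eq) = (e , Sum.swap joins) , eq

    rung : ∀ i o → verticalPrice (λ _ → M (toℕ i)) (toℕ o) ≡ cheap →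
           Cheap (0F , column i o) (1F , column i o)
    rung i o eq = (vertical 0F (column i o) , inj₁ refl) , trans (verticalPrice-combine M i o) eq

    rail : ∀ r i o i′ o′ → toℕ (column i′ o′) ≡ suc (toℕ (column i o)) →
           horizontalPrice r (λ _ → M (toℕ i)) (toℕ o) ≡ cheap →
           Cheap (r , column i o) (r , column i′ o′)
    rail r i o i′ o′ next eq =
      let e , ends , price = horizontalEdge r (column i o) (column i′ o′) next
      in (e , inj₁ ends) , trans (price M) (trans (horizontalPrice-combine r M i o) eq)

    next-column : ∀ i {o o′ : Fin 3} → toℕ o′ ≡ suc (toℕ o) → toℕ (column i o′) ≡ suc (toℕ (column i o))
    next-column i {o} {o′} eq = begin
      toℕ (column i o′)         ≡⟨ toℕ-combine i o′ ⟩
      3 * toℕ i + toℕ o′        ≡⟨ cong (λ x → 3 * toℕ i + x) eq ⟩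
      3 * toℕ i + suc (toℕ o)   ≡⟨ +-suc (3 * toℕ i) (toℕ o) ⟩
      suc (3 * toℕ i + toℕ o)   ≡⟨ cong suc (toℕ-combine i o) ⟨
      suc (toℕ (column i o))    ∎
      where open ≡-Reasoning

    next-block : (i : Fin b) → toℕ (column (suc i) 0F) ≡ suc (toℕ (column (inject₁ i) 2F))
    next-block i = begin
      toℕ (column (suc i) 0F)              ≡⟨ toℕ-combine (suc i) 0F ⟩
      3 * suc (toℕ i) + 0                  ≡⟨ +-identityʳ _ ⟩
      3 * suc (toℕ i)                      ≡⟨ *-suc 3 (toℕ i) ⟩
      3 + 3 * toℕ i                        ≡⟨ +-comm 3 _ ⟩
      3 * toℕ i + 3                        ≡⟨ +-suc (3 * toℕ i) 2 ⟩
      suc (3 * toℕ i + 2)                  ≡⟨ cong (λ x → suc (3 * x + 2)) (toℕ-inject₁ i) ⟨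
      suc (3 * toℕ (inject₁ i) + 2)        ≡⟨ cong suc (toℕ-combine (inject₁ i) 2F) ⟨
      suc (toℕ (column (inject₁ i) 2F))    ∎
      where open ≡-Reasoning

    cheap-step : ∀ {u v} (a : Cheap u v) {x y} → x ≤ y → x + c (proj₁ (proj₁ a)) ≤ suc y
    cheap-step (_ , eq) {x} {y} x≤y rewrite eq = subst (x + 1 ≤_) (+-comm y 1) (+-monoˡ-≤ 1 x≤y)

    Traversal : ∀ {s u} → Fin (suc b) → Path s u → ℕ → Set
    Traversal {s} i p x = Σ (Path s (0F , column i 2F)) λ q →
      cost c q ≤ x × (∀ {w} → w ∈ visited p → w ∈ visited q) × (∀ r o → (r , column i o) ∈ visited q)

    six : ∀ {s} i {u₁ u₂ u₃ u₄ u₅} (p : Path s (0F , column i 0F)) {x} → cost c p ≤ x →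
      Cheap (0F , column i 0F) u₁ → Cheap u₁ u₂ → Cheap u₂ u₃ → Cheap u₃ u₄ → Cheap u₄ u₅ →
      Cheap u₅ (0F , column i 2F) →
      (∀ r o → (r , column i o) ∈ (0F , column i 2F) ∷ u₅ ∷ u₄ ∷ u₃ ∷ u₂ ∷ u₁ ∷ visited p) →
      Traversal i p (6 + x)
    six i p p≤x a₁ a₂ a₃ a₄ a₅ a₆ all =
      p ▷ proj₁ a₁ ▷ proj₁ a₂ ▷ proj₁ a₃ ▷ proj₁ a₄ ▷ proj₁ a₅ ▷ proj₁ a₆ ,
      cheap-step a₆ (cheap-step a₅ (cheap-step a₄ (cheap-step a₃ (cheap-step a₂ (cheap-step a₁ p≤x))))) ,
      (λ w∈p → there (there (there (there (there (there w∈p)))))) ,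
      all

    -- The dead end is visited first: the positions are 1, 0, 1, 2, 3, 4, 5, joined by six cheap
    -- edges.
    traverse : ∀ {s} i (p : Path s (0F , column i 0F)) {x} → cost c p ≤ x → Traversal i p (6 + x)
    traverse i p p≤x with M (toℕ i) in eq
    ... | below = six i p p≤x
      (rung i 0F refl)
      (back (rung i 0F refl))
      (rail 0F i 0F i 1F (next-column i refl) refl)
      (rung i 1F (cong rungPrice eq))
      (rail 1F i 1F i 2F (next-column i refl) refl)
      (back (rung i 2F refl))
      λ where
        0F 0F → there (there (there (there (here refl))))
        0F 1F → there (there (there (here refl)))
        0F 2F → here refl
        1F 0F → there (there (there (there (there (here refl)))))
        1F 1F → there (there (here refl))
        1F 2F → there (here refl)
    ... | ahead = six i p p≤x
      (rail 0F i 0F i 1F (next-column i refl) refl)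
      (back (rail 0F i 0F i 1F (next-column i refl) refl))
      (rung i 0F refl)
      (rail 1F i 0F i 1F (next-column i refl) (cong railPrice eq))
      (rail 1F i 1F i 2F (next-column i refl) refl)
      (back (rung i 2F refl))
      λ where
        0F 0F → there (there (there (there (here refl))))
        0F 1F → there (there (there (there (there (here refl)))))
        0F 2F → here refl
        1F 0F → there (there (there (here refl)))
        1F 1F → there (there (here refl))
        1F 2F → there (here refl)

    Reached : Fin (suc b) → Set
    Reached i = Σ (Path (s₀ n) (0F , column i 0F)) λ p →
      cost c p ≤ toℕ i * 7 × (∀ i′ → toℕ i′ < toℕ i → ∀ r o → (r , column i′ o) ∈ visited p)

    reach : ∀ i → Reached i
    reach = <-weakInduction Reached (start , z≤n , λ _ ()) λ i (p , p≤ , past) →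
      let q , q≤ , p⊆q , block = traverse (inject₁ i) p p≤
          a = rail 0F (inject₁ i) 2F (suc i) 0F (next-block i) refl
      in q ▷ proj₁ a ,
         subst (λ x → cost c (q ▷ proj₁ a) ≤ 7 + x * 7) (toℕ-inject₁ i) (cheap-step a q≤) ,
         λ i′ i′<1+i r o → there (case m<1+n⇒m<n∨m≡n i′<1+i of λ where
           (inj₁ i′<i) → p⊆q (past i′ (subst (toℕ i′ <_) (sym (toℕ-inject₁ i)) i′<i) r o)
           (inj₂ i′≡i) → subst (λ i → (r , column i o) ∈ visited q)
             (sym (toℕ-injective (trans i′≡i (sym (toℕ-inject₁ i))))) (block r o))

  tour : ∃ λ v → Σ (Path (s₀ n) v) λ p → VisitsAll p × cost c p ≤ suc b * 7
  tour =
    let p , p≤ , past = reach (Fin.fromℕ b)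
        q , q≤ , p⊆q , block = traverse (Fin.fromℕ b) p p≤
        all : ∀ i r o → (r , column i o) ∈ visited q
        all i r o = case m<1+n⇒m<n∨m≡n (toℕ<n i) of λ where
          (inj₁ i<b) → p⊆q (past i (subst (toℕ i <_) (sym (toℕ-fromℕ b)) i<b) r o)
          (inj₂ i≡b) → subst (λ i → (r , column i o) ∈ visited q)
            (sym (toℕ-injective (trans i≡b (sym (toℕ-fromℕ b))))) (block r o)
    in _ , q ,
       (λ (r , j) → subst (λ j → (r , j) ∈ visited q) (combine-remQuot {suc b} 3 j)
         (all (quotient 3 j) r (remainder {suc b} 3 j))) ,
       -- The last block needs no crossing edge and costs 6; this is rounded up to 7.
       ≤-trans q≤ (≤-trans (n≤1+n _) (≤-reflexive (cong (λ x → 7 + x * 7) (toℕ-fromℕ b))))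

-- Hard weights for a given algorithm

module _ {k : ℕ} (5≤k : 5 ≤ k) (b : ℕ) where

  private
    n : ℕ
    n = suc b * 3

  lowerBound : ∀ {v} (p : Path (s₀ n) v) → VisitsAll p → suc b * 9 ≤ suc (cost (adaptive 5≤k Start-place p) p)
  lowerBound {v} p visitsAll = begin
    suc b * 9
      ≡⟨ ∑-const (suc b) 9 ⟨
    ∑[ suc b ] (λ _ → 9)
      ≤⟨ ∑-mono (suc b) (λ i i<1+b → altitude-end (stage i p) (placeOf i v) (seen i i<1+b)) ⟩
    ∑[ suc b ] (λ i → altitude (stage i p) (placeOf i v) + inside (placeOf i v))
      ≡⟨ ∑-+ (suc b) (λ i → altitude (stage i p) (placeOf i v)) (λ i → inside (placeOf i v)) ⟩
    ∑[ suc b ] (λ i → altitude (stage i p) (placeOf i v)) + ∑[ suc b ] (λ i → inside (placeOf i v))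
      ≤⟨ +-mono-≤ (altitude≤cost 5≤k Start-place (suc b) p) (∑-inside (suc b) (proj₁ v) (toℕ (proj₂ v))) ⟩
    cost (adaptive 5≤k Start-place p) p + 1
      ≡⟨ +-comm _ 1 ⟩
    suc (cost (adaptive 5≤k Start-place p) p) ∎
    where
    open ≤-Reasoning
    seen : ∀ i → i < suc b → ∀ r o → Seen (stage i p) (at r o)
    seen i i<1+b r o = subst (Seen (stage i p)) place≡
      (stage-Seen Start-place i p (visitsAll (r , combine (fromℕ< i<1+b) o)))
      where
      place≡ : place r i (toℕ (combine (fromℕ< i<1+b) o)) ≡ at r o
      place≡ = subst (λ j → place r j (toℕ (combine (fromℕ< i<1+b) o)) ≡ at r o)
                     (toℕ-fromℕ< i<1+b) (place-combine r (fromℕ< i<1+b) o)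

  hardWeights : (alg : OnlineAlgorithm n k) → ∃ λ M → suc b * 9 ≤ suc (algCost n alg (weights 5≤k M))
  hardWeights alg = plans p , bound (outcome E)
    where
    open OnlineAlgorithm alg
    -- Weights are at least 1, so a path with `suc b * 9` moves is expensive enough already and the
    -- play may be cut off there.
    played = play-exploration strategy (adaptive 5≤k Start-place) (adaptive-agree 5≤k Start-place) (suc b * 9)
    p = proj₁ (proj₂ played)
    outcome = proj₂ (proj₂ played)
    E = explores (weights 5≤k (plans p))
    open Exploration E

    bound : suc b * 9 ≤ length path ⊎ _≡_ {A = State strategy} (_ , path) (_ , p) →
            suc b * 9 ≤ suc (cost (adaptive 5≤k Start-place p) path)
    bound (inj₁ long) = ≤-trans long (≤-trans (length≤cost (weights-positive 5≤k (plans p)) path) (n≤1+n _))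
    bound (inj₂ eq) = transport path visitsAll eq
      where
      -- With end vertex and path generalised to variables, the equation of dependent pairs can be
      -- matched.
      transport : ∀ {v} (q : Path (s₀ n) v) → VisitsAll q → _≡_ {A = State strategy} (v , q) (_ , p) →
                  suc b * 9 ≤ suc (cost (adaptive 5≤k Start-place p) q)
      transport q all refl = lowerBound q all

-- Optimal tours

-- Double negation avoids deciding P; it is harmless, since the real inequality
-- to be proved is stable.
least : ∀ {P : ℕ → Set} b → P b → ¬ ¬ (∃ λ m → m ≤ b × P m × ∀ x → P x → m ≤ x)
least {P} b Pb none = <-rec (λ m → m ≤ b → ¬ P m)
  (λ m rec m≤b Pm → none (m , m≤b , Pm , λ x Px → ≮⇒≥ λ x<m → rec x<m (≤-trans (<⇒≤ x<m) m≤b) Px))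
  b ≤-refl Pb

optimum : ∀ {k} (5≤k : 5 ≤ k) b M →
          ¬ ¬ (∃ λ opt → IsOptCost (suc b * 3) (weight (weights {k} 5≤k M)) opt × opt ≤ suc b * 7)
optimum {k} 5≤k b M none =
  let v , p , all , p≤ = tour {k} {b} M
  in least {P} _ (v , p , all , refl) λ (opt , opt≤ , attained , minimal) →
    none (opt , (attained , λ q all → minimal _ (_ , q , all , refl)) , ≤-trans opt≤ p≤)
  where
  P : ℕ → Set
  P x = ∃ λ v → Σ (Path (s₀ (suc b * 3)) v) λ p → VisitsAll p × cost (weight (weights {k} 5≤k M)) p ≡ x

-- Rational estimates

private
  ι : ℕ → ℚ
  ι n = + n ℚ./ 1

  ι′ : ℕ → ℚ
  ι′ n = fromℤ (+ n)

  -- `fromℤ` displays numerator and denominator, whereas `/` first divides out a gcd; order and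
  -- arithmetic are computed on the former.
  ι≡ι′ : ∀ n → ι n ≡ ι′ n
  ι≡ι′ n = ℚ.↥p/↧p≡p (ι′ n)

  ι-+ : ∀ m n → ι m ℚ.+ ι n ≡ ι (m + n)
  ι-+ m n rewrite ι≡ι′ m | ι≡ι′ n = cong (ℚ._/ 1) (cong₂ ℤ._+_ (ℤ.*-identityʳ (+ m)) (ℤ.*-identityʳ (+ n)))

  ι-* : ∀ m n → ι m ℚ.* ι n ≡ ι (m * n)
  ι-* m n rewrite ι≡ι′ m | ι≡ι′ n = cong (ℚ._/ 1) (sym (ℤ.pos-* m n))

  ι-mono : ∀ {m n} → m ≤ n → ι m ℚ.≤ ι n
  ι-mono {m} {n} m≤n rewrite ι≡ι′ m | ι≡ι′ n = ℚ.*≤* (ℤ.*-monoʳ-≤-nonNeg (+ 1) (ℤ.+≤+ m≤n))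

  ι-cancel : ∀ {m n} → ι m ℚ.≤ ι n → m ≤ n
  ι-cancel {m} {n} m≤n rewrite ι≡ι′ m | ι≡ι′ n =
    ℤ.drop‿+≤+ (ℤ.*-cancelʳ-≤-pos (+ m) (+ n) (+ 1) (ℚ.drop-*≤* m≤n))

  p≤∣p∣ : ∀ p → p ℚ.≤ ℚ.∣ p ∣
  p≤∣p∣ (mkℚ (+ n) d c)    = ℚ.≤-refl
  p≤∣p∣ (mkℚ -[1+ n ] d c) = ℚ.*≤* ℤ.-≤+

  p≤∣↥p∣ : ∀ p → p ℚ.≤ ι ℤ.∣ ↥ p ∣
  p≤∣↥p∣ p@(mkℚ (+ n) d c) rewrite ι≡ι′ n = ℚ.*≤* (ℤ.*-monoˡ-≤-nonNeg (+ n) (ℤ.+≤+ (s≤s z≤n)))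
  p≤∣↥p∣ p@(mkℚ -[1+ n ] d c) rewrite ι≡ι′ (suc n) = ℚ.*≤* ℤ.-≤+

  close : ∀ {p q d} → ℚ.∣ p ℚ.- q ∣ ℚ.≤ d → p ℚ.≤ q ℚ.+ d
  close {p} {q} {d} ∣p-q∣≤d = begin
    p                  ≡⟨ solve 2 (λ p q → p := q :+ (p :- q)) refl p q ⟩
    q ℚ.+ (p ℚ.- q)    ≤⟨ ℚ.+-monoʳ-≤ q (ℚ.≤-trans (p≤∣p∣ (p ℚ.- q)) ∣p-q∣≤d) ⟩
    q ℚ.+ d            ∎
    where
    open ℚ.≤-Reasoning
    open +-*-Solver

  -- Bounding the optimum by a multiple of 4 turns the factor 5/4 into an inequality between natural
  -- numbers.
  estimate : ∀ {r a A opt x B} → r ℚ.≤ + 5 ℚ./ 4 → a ℚ.≤ ι B → opt ≤ 4 * x →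
             ι A ℚ.≤ r ℚ.* ι opt ℚ.+ a ℚ.+ ι 1 → A ≤ 5 * x + B + 1
  estimate {r} {a} {A} {opt} {x} {B} r≤ a≤ opt≤ A≤ = ι-cancel (begin
    ι A                                          ≤⟨ A≤ ⟩
    r ℚ.* ι opt ℚ.+ a ℚ.+ ι 1                    ≤⟨ ℚ.+-monoˡ-≤ (ι 1) (ℚ.+-mono-≤ bound a≤) ⟩
    ι (5 * x) ℚ.+ ι B ℚ.+ ι 1                    ≡⟨ cong (ℚ._+ ι 1) (ι-+ (5 * x) B) ⟩
    ι (5 * x + B) ℚ.+ ι 1                        ≡⟨ ι-+ (5 * x + B) 1 ⟩
    ι (5 * x + B + 1)                            ∎)
    where
    open ℚ.≤-Reasoning
    bound : r ℚ.* ι opt ℚ.≤ ι (5 * x)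
    bound = begin
      r ℚ.* ι opt                      ≤⟨ ℚ.*-monoʳ-≤-nonNeg (ι opt) {{ℚ.nonNegative (ι-mono {0} {opt} z≤n)}} r≤ ⟩
      + 5 ℚ./ 4 ℚ.* ι opt              ≤⟨ ℚ.*-monoˡ-≤-nonNeg (+ 5 ℚ./ 4) (ι-mono opt≤) ⟩
      + 5 ℚ./ 4 ℚ.* ι (4 * x)          ≡⟨ cong (+ 5 ℚ./ 4 ℚ.*_) (ι-* 4 x) ⟨
      + 5 ℚ./ 4 ℚ.* (ι 4 ℚ.* ι x)      ≡⟨ ℚ.*-assoc (+ 5 ℚ./ 4) (ι 4) (ι x) ⟨
      ι 5 ℚ.* ι x                      ≡⟨ ι-* 5 x ⟩
      ι (5 * x)                        ∎

  eventually-bounded : (α : ℝ) → ∃ λ N → ∃ λ B → ∀ i → N ≤ i → seq α i ℚ.≤ ι B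
  eventually-bounded α with cauchy α 1ℚ (ℚ.positive⁻¹ 1ℚ)
  ... | N , near = N , ℤ.∣ ↥ seq α N ∣ + 1 , λ i N≤i → begin
    seq α i                         ≤⟨ close (near i N N≤i ≤-refl) ⟩
    seq α N ℚ.+ 1ℚ                  ≤⟨ ℚ.+-monoˡ-≤ 1ℚ (p≤∣↥p∣ (seq α N)) ⟩
    ι ℤ.∣ ↥ seq α N ∣ ℚ.+ ι 1       ≡⟨ ι-+ ℤ.∣ ↥ seq α N ∣ 1 ⟩
    ι (ℤ.∣ ↥ seq α N ∣ + 1)         ∎
    where open ℚ.≤-Reasoning

  -- The number 5/4 = 90/72 lies strictly between 11/9 = 88/72 and 9/7. So 89/72 is the midpoint of
  -- 11/9 and 5/4, and 1/72 is half their distance.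
  stays-above : ∀ {x y} → + 89 / 72 ℚ.≤ x → ℚ.∣ x ℚ.- y ∣ ℚ.≤ + 1 / 72 → + 11 / 9 ℚ.≤ y
  stays-above {x} {y} x≥ ∣x-y∣≤ = begin
    + 89 / 72 ℚ.- + 1 / 72         ≤⟨ ℚ.+-monoˡ-≤ (ℚ.- (+ 1 / 72)) (ℚ.≤-trans x≥ (close ∣x-y∣≤)) ⟩
    y ℚ.+ + 1 / 72 ℚ.- + 1 / 72    ≡⟨ ℚ.+-assoc y (+ 1 / 72) (ℚ.- (+ 1 / 72)) ⟩
    y ℚ.+ 0ℚ                       ≡⟨ ℚ.+-identityʳ y ⟩
    y                              ∎
    where open ℚ.≤-Reasoning

  stays-below : ∀ {x y} → ¬ + 89 / 72 ℚ.≤ x → ℚ.∣ y ℚ.- x ∣ ℚ.≤ + 1 / 72 → y ℚ.≤ + 5 / 4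
  stays-below {x} {y} x≱ ∣y-x∣≤ = ℚ.≤-trans (close ∣y-x∣≤) (ℚ.+-monoˡ-≤ (+ 1 / 72) (ℚ.<⇒≤ (ℚ.≰⇒> x≱)))

  -- On `4 * m` blocks the agent pays at least 36m - 1, but a ratio of 5/4 allows only 35m plus a
  -- constant.
  count : ∀ {m A B} → 4 * m * 9 ≤ suc A → A ≤ 5 * (m * 7) + B + 1 → m ≤ 2 + B
  count {m} {A} {B} 36m≤ A≤ = +-cancelˡ-≤ (5 * (m * 7)) _ _ (begin
    5 * (m * 7) + m              ≡⟨ nine m ⟩
    4 * m * 9                    ≤⟨ 36m≤ ⟩
    suc A                        ≤⟨ s≤s A≤ ⟩
    suc (5 * (m * 7) + B + 1)    ≡⟨ shuffle (5 * (m * 7)) B ⟩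
    5 * (m * 7) + (2 + B)        ∎)
    where
    open ≤-Reasoning
    nine : ∀ m → 5 * (m * 7) + m ≡ 4 * m * 9
    nine = solve-∀
    shuffle : ∀ x B → suc (x + B + 1) ≡ x + (2 + B)
    shuffle = solve-∀

-- Contradiction on long ladders

refute : ∀ {k} (5≤k : 5 ≤ k) b m → suc b ≡ 4 * m → (alg : OnlineAlgorithm (suc b * 3) k) →
  (r α : ℝ) → ∀ {N N′ B} → (∀ i → N ≤ i → seq r i ℚ.≤ + 5 / 4) → (∀ i → N′ ≤ i → seq α i ℚ.≤ + B / 1) →
  (∀ c opt → IsOptCost (suc b * 3) (weight c) opt →
    fromℕ (algCost (suc b * 3) alg c) ≤ℝ r *ℝ fromℕ opt +ℝ α) →
  ¬ ¬ (m ≤ 2 + B)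
refute 5≤k b m 1+b≡4m alg r α {N} {N′} r≤5/4 α≤B competitive none =
  let M , hard = hardWeights 5≤k b alg
      A = algCost (suc b * 3) alg (weights 5≤k M) in
  optimum 5≤k b M λ (opt , isOpt , opt≤) →
    let N″ , bounded = competitive (weights 5≤k M) opt isOpt 1ℚ (ℚ.positive⁻¹ 1ℚ)
        i = N ⊔ N′ ⊔ N″
        N⊔N′≤i = m≤m⊔n (N ⊔ N′) N″
    in none (count {m} {A} (subst (λ x → x * 9 ≤ suc A) 1+b≡4m hard)
         (estimate {A = A} {opt} {m * 7}
           (r≤5/4 i (≤-trans (m≤m⊔n N N′) N⊔N′≤i))
           (α≤B i (≤-trans (m≤n⊔m N N′) N⊔N′≤i))
           (≤-trans opt≤ (≤-reflexive (trans (cong (_* 7) 1+b≡4m) (*-assoc 4 m 7))))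
           (bounded i (m≤n⊔m (N ⊔ N′) N″))))

theorem2 : (k : ℕ) → 5 ≤ k →
    (alg : (n : ℕ) .{{_ : NonZero n}} → 4 ∣ n → OnlineAlgorithm n k) →
    (r α : ℝ) → fromℕ 0 ≤ℝ α →
    ((n : ℕ) .{{_ : NonZero n}} (4∣n : 4 ∣ n) (c : WeightFunction k 2 n) (opt : ℕ) →
    IsOptCost n (weight c) opt →
    fromℕ (algCost n (alg n 4∣n) c) ≤ℝ r *ℝ fromℕ opt +ℝ α) →
    fromℚ (+ 11 / 9) ≤ℝ r
theorem2 k 5≤k alg r α _ competitive =
  let N , near = cauchy r (+ 1 / 72) (ℚ.positive⁻¹ (+ 1 / 72))
      N′ , B , α≤B = eventually-bounded α
      4∣n = ∣m⇒∣m*n 3 (m∣m*n (3 + B))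
  -- A single rational approximation is compared, which is decidable; from `N` on, all terms are
  -- then at least 11/9 or all are at most 5/4.
  in case + 89 / 72 ℚ.≤? seq r N of λ where
    (yes large) ε ε>0 → N , λ i N≤i → ℚ.≤-trans (stays-above large (near N i ≤-refl N≤i))
      (subst (ℚ._≤ seq r i ℚ.+ ε) (ℚ.+-identityʳ (seq r i)) (ℚ.+-monoʳ-≤ (seq r i) (ℚ.<⇒≤ ε>0)))
    -- `m = 3 + B` exceeds the bound `2 + B` by one; taking `4 * m` blocks also makes the number of
    -- columns divisible by 4.
    (no small) → ⊥-elim (refute 5≤k _ (3 + B) refl (alg (4 * (3 + B) * 3) 4∣n) r α
      (λ i N≤i → stays-below small (near i N N≤i ≤-refl))
      α≤B (competitive _ 4∣n) 1+n≰n)
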